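{- For every accuracy $\delta\in(0,1]$ (in particular for arbitrarily small $\delta>0$), there is no online algorithm for Online Bin Packing with Estimated Item Sizes with accuracy $\delta$ that is $c$-competitive for some $c<\frac{4}{3}$.
   Context: Online Bin Packing with Estimated Item Sizes: an input is a list $L=a_1,\dots,a_n$ of items. Before any item is revealed, the algorithm receives the accuracy $\delta\in(0,1]$ and an estimated size $c'(a)\in(0,1]$ for every item $a\in L$ (so in particular it knows $n$). The items are then revealed one by one together with their actual sizes $c(a)$, where $c(a)\in[c'(a)(1-\delta),\min(c'(a)(1+\delta),1)]$; each item must be irrevocably assigned to a bin (of capacity $1$; the total size of items in a bin may not exceed $1$) before the next item is revealed. The goal is to minimize the number of bins used. $A(L)$ denotes the number of bins used by algorithm $A$ on $L$ and $OPT(L)$ the minimum number of bins in any packing of $L$. An algorithm $A$ is $c$-competitive if there is a constant $K$ such that $A(L)\le c\cdot OPT(L)+K$ for every input list $L$ (and every admissible choice of estimates and actual sizes).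
   Formalization: The accuracy δ, the ratio c, the constant K, and all estimated and actual item sizes are taken to be rational numbers instead of real numbers. -}

module Defs where

open import Data.Nat as ℕ using (ℕ)
open import Data.Integer using (+_)
open import Data.Rational using (ℚ; 0ℚ; 1ℚ; _+_; _*_; _-_; _≤_; _<_; _⊓_; _/_)
open import Data.List using (List; foldr; map; filter; take; allFin; deduplicate; length)
open import Data.Vec using (Vec; lookup; toList)
open import Data.Fin as Fin using (Fin; toℕ)
open import Data.Product using (Σ; ∃; _×_; _,_)
open import Relation.Binary.Definitions using (DecidableEquality)
open import Relation.Binary.PropositionalEquality using (_≡_)

ℕ→ℚ : ℕ → ℚ
ℕ→ℚ m = (+ m) / 1

sumℚ : List ℚ → ℚ
sumℚ = foldr _+_ 0ℚ

-- An instance with n items: estimates es and actual sizes ss (item i is the i-th revealed).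
-- Admissible for accuracy δ: every estimate in (0,1] and every actual size in
-- [c'(1-δ), min(c'(1+δ),1)].
Admissible : ℚ → {n : ℕ} → Vec ℚ n → Vec ℚ n → Set
Admissible δ {n} es ss = (i : Fin n) →
  (0ℚ < lookup es i) × (lookup es i ≤ 1ℚ) ×
  (lookup es i * (1ℚ - δ) ≤ lookup ss i) ×
  (lookup ss i ≤ (lookup es i * (1ℚ + δ)) ⊓ 1ℚ)

load : {B : Set} → DecidableEquality B → {n : ℕ} → Vec ℚ n → (Fin n → B) → B → ℚ
load _≟B_ {n} ss f b = sumℚ (map (lookup ss) (filter (λ i → f i ≟B b) (allFin n)))

Feasible : {B : Set} → DecidableEquality B → {n : ℕ} → Vec ℚ n → (Fin n → B) → Set
Feasible _≟B_ ss f = ∀ b → load _≟B_ ss f b ≤ 1ℚ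

IsOPT : {n : ℕ} → Vec ℚ n → ℕ → Set
IsOPT {n} ss k =
  (Σ (Fin n → Fin k) λ f → Feasible Fin._≟_ ss f) ×
  ((m : ℕ) (f : Fin n → Fin m) → Feasible Fin._≟_ ss f → k ℕ.≤ m)

-- A deterministic online algorithm (for a fixed accuracy δ, which it knows).
-- Before any item is revealed it knows n and the estimates of all items; when
-- item i arrives it sees the actual sizes of items revealed so far (its own past
-- decisions are then determined) and the actual size of item i, and outputs the
-- label of the bin (a natural number) into which item i is irrevocably placed.
OnlineAlg : Set
OnlineAlg = (n : ℕ) → Vec ℚ n → List ℚ → ℚ → ℕ

run : OnlineAlg → {n : ℕ} → Vec ℚ n → Vec ℚ n → Fin n → ℕ
run A {n} es ss i = A n es (take (toℕ i) (toList ss)) (lookup ss i)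

binsUsed : OnlineAlg → {n : ℕ} → Vec ℚ n → Vec ℚ n → ℕ
binsUsed A {n} es ss = length (deduplicate ℕ._≟_ (map (run A es ss) (allFin n)))

Valid : ℚ → OnlineAlg → Set
Valid δ A = (n : ℕ) (es ss : Vec ℚ n) → Admissible δ es ss → Feasible ℕ._≟_ ss (run A es ss)

Competitive : ℚ → OnlineAlg → ℚ → Set
Competitive δ A c = ∃ λ (K : ℚ) → (n : ℕ) (es ss : Vec ℚ n) → Admissible δ es ss →
  (k : ℕ) → IsOPT ss k → ℕ→ℚ (binsUsed A es ss) ≤ c * ℕ→ℚ k + K

{-# OPTIONS --safe #-}
module Submission where

open import Defs
open import Data.Fin as Fin using (Fin; zero; suc; toℕ)
open import Data.Integer using (+_)
import Data.Integer as ℤ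
import Data.Integer.Properties as ℤ
open import Data.List
  using (List; []; _∷_; _++_; [_]; map; filter; length; tabulate; take; replicate; deduplicate; allFin)
import Data.List.Properties as List
open import Data.List.Membership.Propositional using (_∈_; _∉_)
open import Data.List.Membership.Propositional.Properties
  using (∈-∃++; ∈-deduplicate⁺; ∈-++⁻; ∈-++⁺ˡ; ∈-++⁺ʳ)
open import Data.List.Relation.Binary.Permutation.Propositional as ↭
  using (_↭_; ↭-sym; ↭-trans; ↭-refl; ↭-reflexive)
import Data.List.Relation.Binary.Permutation.Propositional.Properties as Perm
open import Data.List.Relation.Unary.All as All using (All; []; _∷_)
import Data.List.Relation.Unary.All.Properties as All
open import Data.List.Relation.Unary.AllPairs using ([]; _∷_)
open import Data.List.Relation.Unary.Any using (here; there)
open import Data.List.Relation.Unary.Unique.Propositional using (Unique)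
import Data.List.Relation.Unary.Unique.Propositional.Properties as Unique
open import Data.Nat as ℕ using (ℕ; zero; suc)
open import Data.Nat.Induction using (<-rec)
import Data.Nat.Properties as ℕ
open import Data.List.Membership.DecPropositional ℕ._≟_ using (_∈?_)
open import Data.Product using (Σ; ∃; _×_; _,_; proj₁; proj₂; map₂)
open import Data.Rational
  using (ℚ; 0ℚ; 1ℚ; ½; _<_; _≤_; _/_; _+_; _-_; _*_; _⊓_; _⊔_; 1/_;
         Positive; positive; NonZero; nonNegative)
import Data.Rational as ℚ using (toℚᵘ; ↥_; ↧_; ↧ₙ_)
import Data.Rational.Properties as ℚ
open import Data.Rational.Solver using (module +-*-Solver)
import Data.Rational.Unnormalised as ℚᵘ
import Data.Rational.Unnormalised.Properties as ℚᵘ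
open import Data.Sum using (_⊎_; inj₁; inj₂)
open import Data.Vec as Vec using (Vec; []; _∷_; lookup; toList)
open import Data.Vec.Membership.Propositional.Properties using (∈-lookup; ∈-toList⁺)
import Data.Vec.Properties as Vec
open import Function using (_∘_; id)
open import Relation.Binary.Definitions using (DecidableEquality)
open import Relation.Binary.PropositionalEquality
  using (_≡_; refl; sym; trans; cong; cong₂; subst; module ≡-Reasoning)
open import Relation.Nullary using (¬_; yes; no; contradiction; from-yes)

-- All 2N items (N = 3r) have estimate 1/2. The first N items lie just below 1/2 and are chosen
-- adaptively: each new size lies strictly between lo and hi, and becomes the new hi if the
-- algorithm opens a bin for it, the new lo if the item joins an earlier one. At the end
-- joiners ≤ lo < hi ≤ openers ≤ h < 1/2. With f openers and y joiners (f + y = N) the adversary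
-- continues in one of two ways, both of which admit a packing into N + 1 bins.
--   y ≥ r: N items 1 - h, each of which fits together with any one earlier item. The joiners
--   are in different bins, as three items never fit, and an item 1 - h fits neither with another
--   one nor into the bin of a joiner, so at least y + N ≥ 4r bins are used.
--   y < r: y + ⌈f/2⌉ items 1 - lo followed by ⌊f/2⌋ items lo. A good packing pairs the openers
--   among themselves and every item 1 - lo with a joiner or with an item lo. The algorithm
--   cannot put 1 - lo into an open bin, as each of these contains an opener or another item 1 - lo,
--   so at least f + y + ⌈f/2⌉ ≥ 4r bins are used.

private
  variable
    A B : Set
    k m n : ℕ

-- Counting distinct labels, and the weights of bins in packings.

unique-⊆⇒length≤ : {xs ys : List A} → Unique xs → (∀ {x} → x ∈ xs → x ∈ ys) →
                   length xs ℕ.≤ length ys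
unique-⊆⇒length≤ {xs = []} _ _ = ℕ.z≤n
unique-⊆⇒length≤ {A} {x ∷ xs} (x∉xs ∷ xs!) xs⊆ys with ∈-∃++ (xs⊆ys (here refl))
... | as , bs , refl = begin
  suc (length xs)         ≤⟨ ℕ.s≤s (unique-⊆⇒length≤ xs! xs⊆as++bs) ⟩
  suc (length (as ++ bs)) ≡⟨ Perm.↭-length (Perm.shift x as bs) ⟨
  length (as ++ x ∷ bs)   ∎
  where
  open ℕ.≤-Reasoning
  xs⊆as++bs : ∀ {y} → y ∈ xs → y ∈ as ++ bs
  xs⊆as++bs y∈xs with Perm.∈-resp-↭ (Perm.shift x as bs) (xs⊆ys (there y∈xs))
  ... | here refl = contradiction refl (All.lookup x∉xs y∈xs)
  ... | there y∈  = y∈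

-- Unlike assignments indexed by `Fin`, lists of placed items can be concatenated and permuted
-- freely; `load≡weight` translates.
Packing : Set → Set
Packing B = List (ℚ × B)

labels : Packing B → List B
labels = map proj₂

module _ (_≟_ : DecidableEquality B) where

  weight : Packing B → B → ℚ
  weight P b = sumℚ (map proj₁ (filter (λ p → proj₂ p ≟ b) P))

  weight-++ : ∀ P Q b → weight (P ++ Q) b ≡ weight P b + weight Q b
  weight-++ []            Q b = sym (ℚ.+-identityˡ _)
  weight-++ ((q , c) ∷ P) Q b with c ≟ b
  ... | no  _ = weight-++ P Q b
  ... | yes _ = trans (cong (_+_ q) (weight-++ P Q b)) (sym (ℚ.+-assoc q _ _))

  weight-↭ : ∀ {P Q} → P ↭ Q → ∀ b → weight P b ≡ weight Q b
  weight-↭ P↭Q b = sum-↭ (Perm.map⁺ proj₁ (Perm.filter-↭ (λ p → proj₂ p ≟ b) P↭Q))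
    where
    open ≡-Reasoning
    sum-↭ : ∀ {xs ys} → xs ↭ ys → sumℚ xs ≡ sumℚ ys
    sum-↭ ↭.refl = refl
    sum-↭ (↭.prep x p) = cong (_+_ x) (sum-↭ p)
    sum-↭ (↭.trans p q) = trans (sum-↭ p) (sum-↭ q)
    sum-↭ {x ∷ y ∷ xs} {_ ∷ _ ∷ ys} (↭.swap x y p) = begin
      x + (y + sumℚ xs) ≡⟨ ℚ.+-assoc x y _ ⟨
      x + y + sumℚ xs   ≡⟨ cong₂ _+_ (ℚ.+-comm x y) (sum-↭ p) ⟩
      y + x + sumℚ ys   ≡⟨ ℚ.+-assoc y x _ ⟩
      y + (x + sumℚ ys) ∎

  module _ {s : ℚ} (0≤s : 0ℚ ≤ s) where

    AtLeast : Packing B → Set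
    AtLeast = All (λ p → s ≤ proj₁ p)

    0≤weight : ∀ {P} → AtLeast P → ∀ b → 0ℚ ≤ weight P b
    0≤weight []                      b = ℚ.≤-refl
    0≤weight {(_ , c) ∷ _} (s≤q ∷ P) b with c ≟ b
    ... | no  _ = 0≤weight P b
    ... | yes _ = ℚ.+-mono-≤ (ℚ.≤-trans 0≤s s≤q) (0≤weight P b)

    ∈⇒≤weight : ∀ {P b} → AtLeast P → b ∈ labels P → s ≤ weight P b
    ∈⇒≤weight {(q , c) ∷ P} {b} (s≤q ∷ s≤P) b∈ with c ≟ b | b∈
    ... | no c≢b | here refl = contradiction refl c≢b
    ... | no _   | there b∈P = ∈⇒≤weight s≤P b∈P
    ... | yes _  | _         = begin
      s                 ≡⟨ ℚ.+-identityʳ s ⟨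
      s + 0ℚ            ≤⟨ ℚ.+-mono-≤ s≤q (0≤weight s≤P b) ⟩
      q + weight P b    ∎
      where open ℚ.≤-Reasoning

    -- A repeated label would put two items of size at least `s` into one bin, whose weight would
    -- then reach `s + s`.
    light⇒unique : ∀ {P} → AtLeast P → (∀ {b} → b ∈ labels P → weight P b < s + s) →
                   Unique (labels P)
    light⇒unique {[]}          _           _     = []
    light⇒unique {(q , c) ∷ P} (s≤q ∷ s≤P) light =
      All.¬Any⇒All¬ _ c∉P ∷ light⇒unique s≤P λ b∈P → ℚ.≤-<-trans tail≤ (light (there b∈P))
      where
      tail≤ : ∀ {b} → weight P b ≤ weight ((q , c) ∷ P) b
      tail≤ {b} with c ≟ b
      ... | no  _ = ℚ.≤-refl
      ... | yes _ = begin
        weight P b      ≡⟨ ℚ.+-identityˡ _ ⟨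
        0ℚ + weight P b ≤⟨ ℚ.+-monoˡ-≤ _ (ℚ.≤-trans 0≤s s≤q) ⟩
        q + weight P b  ∎
        where open ℚ.≤-Reasoning
      c∉P : c ∉ labels P
      c∉P c∈P with c ≟ c | light (here refl)
      ... | no c≢c | _ = c≢c refl
      ... | yes _  | q+w<s+s = ℚ.<-irrefl refl (ℚ.≤-<-trans (ℚ.+-mono-≤ s≤q (∈⇒≤weight s≤P c∈P)) q+w<s+s)

  load≡weight : (ss : Vec ℚ n) (f : Fin n → B) (b : B) →
                load _≟_ ss f b ≡ weight (tabulate (λ i → lookup ss i , f i)) b
  load≡weight {n} ss f b = go id
    where
    -- The tail of `allFin` is a tabulation of `suc`, so the induction ranges over tabulations of an
    -- arbitrary `e`.
    go : ∀ {m} (e : Fin m → Fin n) →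
         sumℚ (map (lookup ss) (filter (λ i → f i ≟ b) (tabulate e))) ≡
         weight (tabulate (λ i → lookup ss (e i) , f (e i))) b
    go {zero}  e = refl
    go {suc m} e with f (e zero) ≟ b
    ... | no  _ = go (e ∘ suc)
    ... | yes _ = cong (_+_ (lookup ss (e zero))) (go (e ∘ suc))

-- Certificates for offline packings.

-- No labels are carried, and `permute` makes the order of the items irrelevant, so a packing can be
-- described bin by bin, independently of the order of arrival.
data Fits : ℕ → List ℚ → Set where
  []      : Fits 0 []
  bin     : ∀ {xs} ys → sumℚ ys ≤ 1ℚ → Fits k xs → Fits (suc k) (ys ++ xs)
  permute : ∀ {xs ys} → xs ↭ ys → Fits k xs → Fits k ys

Fits-++ : ∀ {xs ys} → Fits m xs → Fits n ys → Fits (m ℕ.+ n) (xs ++ ys)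
Fits-++ []            G = G
Fits-++ {ys = zs} (bin {xs = xs} ys ≤1 F) G =
  subst (Fits _) (sym (List.++-assoc ys xs zs)) (bin ys ≤1 (Fits-++ F G))
Fits-++ (permute p F) G = permute (Perm.++⁺ʳ _ p) (Fits-++ F G)

-- A new bin takes the label `zero` and shifts the other labels by `suc`; a permutation of the sizes
-- lifts to the labelled items. The sizes come out in exactly the given order, so that
-- `packing⇒function` can read off an assignment of indices.
Fits⇒packing : ∀ {xs} → Fits k xs → ∃ λ (P : Packing (Fin k)) →
               map proj₁ P ≡ xs × (∀ b → weight Fin._≟_ P b ≤ 1ℚ)
Fits⇒packing [] = [] , refl , λ ()
Fits⇒packing (permute xs↭ys F) with Fits⇒packing F
... | P , refl , P≤1 with Perm.↭-map-inv proj₁ xs↭ys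
...   | Q , eq , P↭Q = Q , sym eq ,
  λ b → subst (_≤ 1ℚ) (weight-↭ Fin._≟_ P↭Q b) (P≤1 b)
Fits⇒packing (bin {k = k} ys ys≤1 F) with Fits⇒packing F
... | P , refl , P≤1 = new ++ old , sizes , bounded
  where
  open ≡-Reasoning
  new old : Packing (Fin (suc k))
  new = map (_, zero) ys
  old = map (map₂ suc) P
  sizes : map proj₁ (new ++ old) ≡ ys ++ map proj₁ P
  sizes = begin
    map proj₁ (new ++ old)           ≡⟨ List.map-++ proj₁ new old ⟩
    map proj₁ new ++ map proj₁ old   ≡⟨ cong₂ _++_ (List.map-∘ ys) (List.map-∘ P) ⟨
    map id ys ++ map proj₁ P         ≡⟨ cong (_++ _) (List.map-id ys) ⟩
    ys ++ map proj₁ P                ∎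
  new-zero : ∀ zs → weight Fin._≟_ (map (_, zero {k}) zs) zero ≡ sumℚ zs
  new-zero []       = refl
  new-zero (z ∷ zs) = cong (_+_ z) (new-zero zs)
  new-suc : ∀ zs (b : Fin k) → weight Fin._≟_ (map (_, zero {k}) zs) (suc b) ≡ 0ℚ
  new-suc []       b = refl
  new-suc (z ∷ zs) b = new-suc zs b
  old-zero : ∀ (Q : Packing (Fin k)) → weight Fin._≟_ (map (map₂ suc) Q) zero ≡ 0ℚ
  old-zero []       = refl
  old-zero (_ ∷ Q) = old-zero Q
  old-suc : ∀ (Q : Packing (Fin k)) b →
            weight Fin._≟_ (map (map₂ suc) Q) (suc b) ≡ weight Fin._≟_ Q b
  old-suc []      b = refl
  old-suc ((q , c) ∷ Q) b with c Fin.≟ b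
  ... | no  _ = old-suc Q b
  ... | yes _ = cong (_+_ q) (old-suc Q b)
  bounded : ∀ b → weight Fin._≟_ (new ++ old) b ≤ 1ℚ
  bounded zero    = subst (_≤ 1ℚ) (sym (trans (weight-++ Fin._≟_ new old zero)
    (trans (cong₂ _+_ (new-zero ys) (old-zero P)) (ℚ.+-identityʳ _)))) ys≤1
  bounded (suc b) = subst (_≤ 1ℚ) (sym (trans (weight-++ Fin._≟_ new old (suc b))
    (trans (cong₂ _+_ (new-suc ys b) (old-suc P b)) (ℚ.+-identityˡ _)))) (P≤1 b)

packing⇒function : (ss : Vec ℚ n) (P : Packing B) → map proj₁ P ≡ toList ss →
                   ∃ λ (f : Fin n → B) → tabulate (λ i → lookup ss i , f i) ≡ P
packing⇒function []       []            _  = (λ ()) , refl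
packing⇒function (s ∷ ss) ((q , b) ∷ P) eq with List.∷-injective eq
... | refl , eq′ with packing⇒function ss P eq′
...   | f , refl = (λ { zero → b ; (suc i) → f i }) , refl

Fits⇒feasible : (ss : Vec ℚ n) → Fits k (toList ss) → ∃ λ f → Feasible {B = Fin k} Fin._≟_ ss f
Fits⇒feasible ss F with Fits⇒packing F
... | P , eq , P≤1 with packing⇒function ss P eq
...   | f , refl = f , λ b → subst (_≤ 1ℚ) (sym (load≡weight Fin._≟_ ss f b)) (P≤1 b)

-- Constructively the optimum is only known not to be absent, which suffices for a negative claim.
¬¬IsOPT : (ss : Vec ℚ n) → Fits k (toList ss) → ¬ (∀ m → m ℕ.≤ k → ¬ IsOPT ss m)
¬¬IsOPT {k = k} ss F ¬opt = go k ℕ.≤-refl (Fits⇒feasible ss F)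
  where
  go : ∀ m → m ℕ.≤ k → ¬ ∃ λ f → Feasible {B = Fin m} Fin._≟_ ss f
  go = <-rec _ λ m rec m≤k feasible → ¬opt m m≤k (feasible , λ j f f≤1 →
    ℕ.≮⇒≥ λ j<m → rec j<m (ℕ.≤-trans (ℕ.<⇒≤ j<m) m≤k) (f , f≤1))

-- Runs of an online algorithm as packings.

-- g decides like an OnlineAlg with n and the estimates fixed; pre lists the sizes already revealed.
play : (List ℚ → ℚ → ℕ) → List ℚ → List ℚ → Packing ℕ
play g pre []       = []
play g pre (x ∷ xs) = (x , g pre x) ∷ play g (pre ++ [ x ]) xs

play-++ : ∀ g pre xs ys → play g pre (xs ++ ys) ≡ play g pre xs ++ play g (pre ++ xs) ys
play-++ g pre []       ys = cong (λ zs → play g zs ys) (sym (List.++-identityʳ pre))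
play-++ g pre (x ∷ xs) ys = cong (_ ∷_) (trans (play-++ g (pre ++ [ x ]) xs ys)
  (cong (λ zs → play g (pre ++ [ x ]) xs ++ play g zs ys) (List.++-assoc pre [ x ] xs)))

play-sizes : ∀ g pre xs → map proj₁ (play g pre xs) ≡ xs
play-sizes g pre []       = refl
play-sizes g pre (x ∷ xs) = cong (x ∷_) (play-sizes g (pre ++ [ x ]) xs)

play-run : ∀ (A : OnlineAlg) (es ss : Vec ℚ n) →
           tabulate (λ i → lookup ss i , run A es ss i) ≡ play (A n es) [] (toList ss)
play-run {n} A es ss = go [] ss
  where
  -- `pre` accumulates the revealed sizes, which `run` instead cuts off the whole vector with
  -- `take`; the two agree at `pre = []`.
  go : ∀ {m} pre (xs : Vec ℚ m) →
       tabulate (λ i → lookup xs i , A n es (pre ++ take (toℕ i) (toList xs)) (lookup xs i)) ≡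
       play (A n es) pre (toList xs)
  go pre []       = refl
  go pre (x ∷ xs) = cong₂ _∷_
    (cong (λ zs → x , A n es zs x) (List.++-identityʳ pre))
    (trans (List.tabulate-cong λ i → cong (λ zs → lookup xs i , A n es zs (lookup xs i))
             (sym (List.++-assoc pre [ x ] (take (toℕ i) (toList xs)))))
           (go (pre ++ [ x ]) xs))


-- Explicit packings with at most two items per bin.

p≤1-q : ∀ {p q} → p + q ≤ 1ℚ → p ≤ 1ℚ - q
p≤1-q {p} {q} p+q≤1 = begin
  p         ≡⟨ solve 2 (λ p q → p := (p :+ q) :- q) refl p q ⟩
  p + q - q ≤⟨ ℚ.+-monoˡ-≤ _ p+q≤1 ⟩
  1ℚ - q    ∎
  where
  open ℚ.≤-Reasoning
  open +-*-Solver

p+[1-p]≡1 : ∀ p → p + (1ℚ - p) ≡ 1ℚ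
p+[1-p]≡1 p = solve 1 (λ p → p :+ (con 1ℚ :- p) := con 1ℚ) refl p
  where open +-*-Solver

-- An item of size at most `u` shares a bin with one of size `1ℚ - u`; once `xs` is exhausted, the
-- remaining large items get bins of their own.
pair-up : ∀ {u xs} → 0ℚ ≤ u → All (_≤ u) xs → length xs ℕ.≤ n →
          Fits n (xs ++ replicate n (1ℚ - u))
pair-up {zero}  {xs = []} _ _ _ = []
pair-up {suc n} {u} {[]} 0≤u [] _ = bin [ 1ℚ - u ] single (pair-up 0≤u [] ℕ.z≤n)
  where
  open ℚ.≤-Reasoning
  single : 1ℚ - u + 0ℚ ≤ 1ℚ
  single = begin
    1ℚ - u + 0ℚ ≤⟨ ℚ.+-monoʳ-≤ (1ℚ - u) 0≤u ⟩
    1ℚ - u + u  ≡⟨ trans (ℚ.+-comm _ u) (p+[1-p]≡1 u) ⟩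
    1ℚ          ∎
pair-up {suc n} {u} {x ∷ xs} 0≤u (x≤u ∷ xs≤u) (ℕ.s≤s len) =
  permute (↭.prep x (↭-sym (Perm.shift (1ℚ - u) xs _)))
    (bin (x ∷ 1ℚ - u ∷ []) pair (pair-up 0≤u xs≤u len))
  where
  open ℚ.≤-Reasoning
  pair : x + (1ℚ - u + 0ℚ) ≤ 1ℚ
  pair = begin
    x + (1ℚ - u + 0ℚ) ≡⟨ cong (_+_ x) (ℚ.+-identityʳ _) ⟩
    x + (1ℚ - u)      ≤⟨ ℚ.+-monoˡ-≤ _ x≤u ⟩
    u + (1ℚ - u)      ≡⟨ p+[1-p]≡1 u ⟩
    1ℚ                ∎

-- Two items of size at most `u` share a bin; if their number is odd, the last one is alone, hence
-- the rounding up.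
pair-off : ∀ {u xs} → 0ℚ ≤ u → u + u ≤ 1ℚ → All (_≤ u) xs → Fits ℕ.⌈ length xs /2⌉ xs
pair-off 0≤u 2u≤1 [] = []
pair-off {u} {x ∷ []} 0≤u 2u≤1 (x≤u ∷ []) =
  bin [ x ] (ℚ.≤-trans (ℚ.+-mono-≤ x≤u 0≤u) 2u≤1) []
pair-off {u} {x ∷ y ∷ xs} 0≤u 2u≤1 (x≤u ∷ y≤u ∷ xs≤u) =
  bin (x ∷ y ∷ []) (ℚ.≤-trans (ℚ.+-mono-≤ x≤u (subst (_≤ u) (sym (ℚ.+-identityʳ y)) y≤u)) 2u≤1)
    (pair-off 0≤u 2u≤1 xs≤u)

-- First phase: adaptive sizes just below one half.

-- Openers and joiners interleave in time, so `played` holds only up to permutation; bin weights and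
-- label sets do not depend on the order.
record SmallPhase (g : List ℚ → ℚ → ℕ) (l h : ℚ) (k : ℕ) : Set where
  field
    history          : List ℚ
    openers joiners  : Packing ℕ
    lo hi            : ℚ
    played           : play g [] history ↭ openers ++ joiners
    count            : length openers ℕ.+ length joiners ≡ k
    l≤lo             : l ≤ lo
    lo<hi            : lo < hi
    hi≤h             : hi ≤ h
    openers-sizes    : All (λ p → hi ≤ proj₁ p × proj₁ p ≤ h) openers
    joiners-sizes    : All (λ p → l ≤ proj₁ p × proj₁ p ≤ lo) joiners
    openers-distinct : Unique (labels openers)
    joiners-join     : All (λ p → proj₂ p ∈ labels openers) joiners

-- A size `m` strictly between `lo` and `hi` is above all joiners and below all openers, so it can
-- go into either class after the algorithm has chosen a bin. Since joiners only use labels of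
-- openers, a label outside these belongs to a new bin.
small-phase : ∀ g {l h} → l < h → ∀ k → SmallPhase g l h k
small-phase g {l} {h} l<h zero = record
  { history = [] ; openers = [] ; joiners = [] ; lo = l ; hi = h
  ; played = ↭-refl ; count = refl
  ; l≤lo = ℚ.≤-refl ; lo<hi = l<h ; hi≤h = ℚ.≤-refl
  ; openers-sizes = [] ; joiners-sizes = [] ; openers-distinct = [] ; joiners-join = []
  }
small-phase g {l} {h} l<h (suc k)
  with small-phase g l<h k
... | ph with ℚ.<-dense (SmallPhase.lo<hi ph)
...   | m , lo<m , m<hi with g (SmallPhase.history ph) m ∈? labels (SmallPhase.openers ph)
...     | no b∉ = record
  { history = history ++ [ m ] ; openers = (m , b) ∷ openers ; joiners = joiners
  ; lo = lo ; hi = m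
  ; played = ↭-trans (↭-reflexive (play-++ g [] history [ m ]))
      (↭-trans (Perm.++⁺ʳ _ played) (↭-sym (Perm.∷↭∷ʳ (m , b) (openers ++ joiners))))
  ; count = cong suc count
  ; l≤lo = l≤lo ; lo<hi = lo<m ; hi≤h = ℚ.<⇒≤ m<h
  ; openers-sizes = (ℚ.≤-refl , ℚ.<⇒≤ m<h) ∷
      All.map (λ (hi≤q , q≤h) → ℚ.≤-trans (ℚ.<⇒≤ m<hi) hi≤q , q≤h) openers-sizes
  ; joiners-sizes = joiners-sizes
  ; openers-distinct = All.¬Any⇒All¬ _ b∉ ∷ openers-distinct
  ; joiners-join = All.map there joiners-join
  }
  where
  open SmallPhase ph
  b = g history m
  m<h : m < h
  m<h = ℚ.<-≤-trans m<hi hi≤h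
...     | yes b∈ = record
  { history = history ++ [ m ] ; openers = openers ; joiners = (m , b) ∷ joiners
  ; lo = m ; hi = hi
  ; played = ↭-trans (↭-reflexive (play-++ g [] history [ m ]))
      (↭-trans (Perm.++⁺ʳ _ played) (↭-trans (↭-sym (Perm.∷↭∷ʳ (m , b) (openers ++ joiners)))
        (↭-sym (Perm.shift (m , b) openers joiners))))
  ; count = trans (ℕ.+-suc _ _) (cong suc count)
  ; l≤lo = ℚ.<⇒≤ l<m ; lo<hi = m<hi ; hi≤h = hi≤h
  ; openers-sizes = openers-sizes
  ; joiners-sizes = (ℚ.<⇒≤ l<m , ℚ.≤-refl) ∷
      All.map (λ (l≤q , q≤lo) → l≤q , ℚ.≤-trans q≤lo (ℚ.<⇒≤ lo<m)) joiners-sizes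
  ; openers-distinct = openers-distinct
  ; joiners-join = b∈ ∷ joiners-join
  }
  where
  open SmallPhase ph
  b = g history m
  l<m : l < m
  l<m = ℚ.≤-<-trans l≤lo lo<m

-- Second phase: items above one half, and the count of bins.

w : Packing ℕ → ℕ → ℚ
w = weight ℕ._≟_

-- `used` assumes the capacity bound for this one run: validity of the algorithm speaks only of
-- admissible inputs, and admissibility is derived from `sizes` later.
record Attack (g : List ℚ → ℚ → ℕ) (l : ℚ) (r : ℕ) : Set where
  field
    items   : List ℚ
    amount  : length items ≡ 3 ℕ.* r ℕ.+ 3 ℕ.* r
    sizes   : All (λ x → l ≤ x × x ≤ 1ℚ - l) items
    bins    : ℕ
    bins≤   : bins ℕ.≤ suc (3 ℕ.* r)
    fits    : Fits bins items
    used    : (∀ b → w (play g [] items) b ≤ 1ℚ) →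
              4 ℕ.* r ℕ.≤ length (deduplicate ℕ._≟_ (labels (play g [] items)))

-- All items will have size at least `l`, so `1<3l` keeps three of them out of one bin; `2h<1` puts
-- every item `1ℚ - u` with `u ≤ h` above one half.
module _ {g l h r} (0≤l : 0ℚ ≤ l) (1<3l : 1ℚ < l + l + l) (2h<1 : h + h < 1ℚ)
         (ph : SmallPhase g l h (3 ℕ.* r)) where
  open SmallPhase ph

  l≤h : l ≤ h
  l≤h = ℚ.≤-trans l≤lo (ℚ.≤-trans (ℚ.<⇒≤ lo<hi) hi≤h)

  openers≥l : All (λ p → l ≤ proj₁ p) openers
  openers≥l = All.map (λ (hi≤q , _) → ℚ.≤-trans l≤lo (ℚ.≤-trans (ℚ.<⇒≤ lo<hi) hi≤q)) openers-sizes

  joiners≥l : All (λ p → l ≤ proj₁ p) joiners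
  joiners≥l = All.map proj₁ joiners-sizes

  history↭ : history ↭ map proj₁ openers ++ map proj₁ joiners
  history↭ = begin
    history                                 ≡⟨ play-sizes g [] history ⟨
    map proj₁ (play g [] history)           ↭⟨ Perm.map⁺ proj₁ played ⟩
    map proj₁ (openers ++ joiners)          ≡⟨ List.map-++ proj₁ openers joiners ⟩
    map proj₁ openers ++ map proj₁ joiners  ∎
    where open ↭.PermutationReasoning

  length-history : length history ≡ 3 ℕ.* r
  length-history = begin
    length history                 ≡⟨ cong length (play-sizes g [] history) ⟨
    length (map proj₁ (play g [] history)) ≡⟨ List.length-map proj₁ (play g [] history) ⟩
    length (play g [] history)     ≡⟨ Perm.↭-length played ⟩
    length (openers ++ joiners)    ≡⟨ List.length-++ openers ⟩
    length openers ℕ.+ length joiners ≡⟨ count ⟩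
    3 ℕ.* r                        ∎
    where open ≡-Reasoning

  history-sizes : All (λ x → l ≤ x × x ≤ h) history
  history-sizes = Perm.All-resp-↭ (↭-sym history↭) (All.++⁺
    (All.map⁺ (All.zip (openers≥l , All.map proj₂ openers-sizes)))
    (All.map⁺ (All.map (λ (l≤q , q≤lo) → l≤q , ℚ.≤-trans q≤lo (ℚ.≤-trans (ℚ.<⇒≤ lo<hi) hi≤h))
      joiners-sizes)))

  -- Shared by both continuations: `u = h` and `q = 0` when there are many joiners, `u = lo` when
  -- there are many openers.
  module LargePhase {u} (l≤u : l ≤ u) (u≤h : u ≤ h) (p q : ℕ) (p+q≡ : p ℕ.+ q ≡ 3 ℕ.* r) where

    bigs smalls items : List ℚ
    bigs   = replicate p (1ℚ - u)
    smalls = replicate q u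
    items  = history ++ bigs ++ smalls

    big small : Packing ℕ
    big   = play g history bigs
    small = play g (history ++ bigs) smalls

    items-played : play g [] items ↭ (openers ++ joiners) ++ big ++ small
    items-played = begin
      play g [] items                                    ≡⟨ play-++ g [] history (bigs ++ smalls) ⟩
      play g [] history ++ play g history (bigs ++ smalls)
        ≡⟨ cong (play g [] history ++_) (play-++ g history bigs smalls) ⟩
      play g [] history ++ big ++ small                  ↭⟨ Perm.++⁺ʳ (big ++ small) played ⟩
      (openers ++ joiners) ++ big ++ small               ∎
      where open ↭.PermutationReasoning

    amount : length items ≡ 3 ℕ.* r ℕ.+ 3 ℕ.* r
    amount = trans (List.length-++ history) (cong₂ ℕ._+_ length-history
      (trans (List.length-++ bigs) (trans (cong₂ ℕ._+_ (List.length-replicate p) (List.length-replicate q)) p+q≡)))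

    2u<1 : u + u < 1ℚ
    2u<1 = ℚ.≤-<-trans (ℚ.+-mono-≤ u≤h u≤h) 2h<1

    0≤u : 0ℚ ≤ u
    0≤u = ℚ.≤-trans 0≤l l≤u

    u≤1-u : u ≤ 1ℚ - u
    u≤1-u = p≤1-q (ℚ.<⇒≤ 2u<1)

    small≤1-l : ∀ {x} → x ≤ h → x ≤ 1ℚ - l
    small≤1-l x≤h = p≤1-q (ℚ.≤-trans (ℚ.+-mono-≤ x≤h l≤h) (ℚ.<⇒≤ 2h<1))

    sizes : All (λ x → l ≤ x × x ≤ 1ℚ - l) items
    sizes = All.++⁺ (All.map (λ (l≤x , x≤h) → l≤x , small≤1-l x≤h) history-sizes)
      (All.++⁺ (All.replicate⁺ p (ℚ.≤-trans l≤u u≤1-u , ℚ.+-monoʳ-≤ 1ℚ (ℚ.neg-antimono-≤ l≤u)))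
               (All.replicate⁺ q (l≤u , small≤1-l u≤h)))

    0≤1-u : 0ℚ ≤ 1ℚ - u
    0≤1-u = ℚ.≤-trans 0≤u u≤1-u

    1<2[1-u] : 1ℚ < 1ℚ - u + (1ℚ - u)
    1<2[1-u] = begin-strict
      1ℚ                  ≡⟨ solve 1 (λ u → con 1ℚ := con 1ℚ :- (u :+ u) :+ (u :+ u)) refl u ⟩
      1ℚ - (u + u) + (u + u) <⟨ ℚ.+-monoʳ-< (1ℚ - (u + u)) 2u<1 ⟩
      1ℚ - (u + u) + 1ℚ   ≡⟨ solve 1 (λ u → con 1ℚ :- (u :+ u) :+ con 1ℚ := con 1ℚ :- u :+ (con 1ℚ :- u)) refl u ⟩
      1ℚ - u + (1ℚ - u)   ∎
      where
      open ℚ.≤-Reasoning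
      open +-*-Solver

    big≥ : All (λ p → 1ℚ - u ≤ proj₁ p) big
    big≥ = All.map⁻ (subst (All (1ℚ - u ≤_)) (sym (play-sizes g history bigs))
      (All.replicate⁺ p ℚ.≤-refl))

    small≥ : All (λ p → u ≤ proj₁ p) small
    small≥ = All.map⁻ (subst (All (u ≤_)) (sym (play-sizes g (history ++ bigs) smalls))
      (All.replicate⁺ q ℚ.≤-refl))

    module _ (valid : ∀ b → w (play g [] items) b ≤ 1ℚ) where

      weights≤1 : ∀ b → w openers b + w joiners b + w big b ≤ 1ℚ
      weights≤1 b = begin
        w openers b + w joiners b + w big b
          ≡⟨ ℚ.+-identityʳ _ ⟨
        w openers b + w joiners b + w big b + 0ℚ
          ≤⟨ ℚ.+-monoʳ-≤ (w openers b + w joiners b + w big b) (0≤weight ℕ._≟_ 0≤u small≥ b) ⟩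
        w openers b + w joiners b + w big b + w small b
          ≡⟨ ℚ.+-assoc (w openers b + w joiners b) _ _ ⟩
        w openers b + w joiners b + (w big b + w small b)
          ≡⟨ cong₂ _+_ (weight-++ ℕ._≟_ openers joiners b) (weight-++ ℕ._≟_ big small b) ⟨
        w (openers ++ joiners) b + w (big ++ small) b
          ≡⟨ weight-++ ℕ._≟_ (openers ++ joiners) (big ++ small) b ⟨
        w ((openers ++ joiners) ++ big ++ small) b
          ≡⟨ weight-↭ ℕ._≟_ items-played b ⟨
        w (play g [] items) b
          ≤⟨ valid b ⟩
        1ℚ ∎
        where open ℚ.≤-Reasoning

      -- Two items `1ℚ - u` together exceed the capacity.
      big-distinct : Unique (labels big)
      big-distinct = light⇒unique ℕ._≟_ 0≤1-u big≥ λ {b} _ → ℚ.≤-<-trans (begin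
        w big b                               ≡⟨ ℚ.+-identityˡ _ ⟨
        0ℚ + 0ℚ + w big b                     ≤⟨ ℚ.+-monoˡ-≤ _ (ℚ.+-mono-≤
          (0≤weight ℕ._≟_ 0≤l openers≥l b) (0≤weight ℕ._≟_ 0≤l joiners≥l b)) ⟩
        w openers b + w joiners b + w big b   ≤⟨ weights≤1 b ⟩
        1ℚ                                    ∎) 1<2[1-u]
        where open ℚ.≤-Reasoning

      -- `X` stands for the joiners in one continuation and for the openers in the other; its bins
      -- are counted on top of those of `big`.
      used : ∀ {X} → Unique (labels X) → (∀ {b} → b ∈ labels X → b ∉ labels big) →
             (∀ {b} → b ∈ labels X → b ∈ labels (openers ++ joiners)) →
             length X ℕ.+ p ℕ.≤ length (deduplicate ℕ._≟_ (labels (play g [] items)))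
      used {X} X! X∩big=∅ X⊆ = begin
        length X ℕ.+ p                            ≡⟨ cong₂ ℕ._+_ (List.length-map proj₂ X) length-big ⟨
        length (labels X) ℕ.+ length (labels big) ≡⟨ List.length-++ (labels X) ⟨
        length (labels X ++ labels big)           ≤⟨ unique-⊆⇒length≤
          (Unique.++⁺ X! big-distinct (λ (b∈X , b∈big) → X∩big=∅ b∈X b∈big)) (∈-deduplicate⁺ ℕ._≟_ ∘ included) ⟩
        length (deduplicate ℕ._≟_ (labels (play g [] items))) ∎
        where
        open ℕ.≤-Reasoning
        length-big : length (labels big) ≡ p
        length-big = trans (List.length-map proj₂ big) (trans (sym (List.length-map proj₁ big))
          (trans (cong length (play-sizes g history bigs)) (List.length-replicate p)))
        included : ∀ {b} → b ∈ labels X ++ labels big → b ∈ labels (play g [] items)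
        included {b} b∈ = Perm.∈-resp-↭ (↭-sym (Perm.map⁺ proj₂ items-played))
          (subst (b ∈_) (sym (List.map-++ proj₂ (openers ++ joiners) (big ++ small))) (in-parts (∈-++⁻ (labels X) b∈)))
          where
          in-parts : b ∈ labels X ⊎ b ∈ labels big → b ∈ labels (openers ++ joiners) ++ labels (big ++ small)
          in-parts (inj₁ b∈X)   = ∈-++⁺ˡ (X⊆ b∈X)
          in-parts (inj₂ b∈big) = ∈-++⁺ʳ (labels (openers ++ joiners))
            (subst (b ∈_) (sym (List.map-++ proj₂ big small)) (∈-++⁺ˡ b∈big))

  attack-joiners : r ℕ.≤ length joiners → Attack g l r
  attack-joiners r≤joiners = record
    { items = items ; amount = amount ; sizes = sizes
    -- One bin per item `1ℚ - h`; the spare bin in `bins≤` serves the other continuation.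
    ; bins = 3 ℕ.* r ; bins≤ = ℕ.n≤1+n _
    ; fits = subst (λ zs → Fits _ (history ++ zs)) (sym (List.++-identityʳ bigs))
        (pair-up 0≤u (All.map proj₂ history-sizes) (ℕ.≤-reflexive length-history))
    ; used = λ valid → ℕ.≤-trans (ℕ.+-monoˡ-≤ _ r≤joiners) (used valid
        (light⇒unique ℕ._≟_ 0≤l joiners≥l (joiners-light valid))
        (disjoint valid)
        λ {b} b∈ → subst (b ∈_) (sym (List.map-++ proj₂ openers joiners)) (∈-++⁺ʳ (labels openers) b∈))
    }
    where
    open LargePhase l≤h ℚ.≤-refl (3 ℕ.* r) 0 (ℕ.+-identityʳ _)
    open ℚ.≤-Reasoning

    opened : ∀ {b} → b ∈ labels joiners → b ∈ labels openers
    opened = All.lookup (All.map⁺ joiners-join)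

    -- The bin of a joiner already holds an opener, so a second joiner would be a third item there.
    joiners-light : (∀ b → w (play g [] items) b ≤ 1ℚ) →
                    ∀ {b} → b ∈ labels joiners → w joiners b < l + l
    joiners-light valid {b} b∈ = ℚ.≰⇒> λ 2l≤joiners → ℚ.<-irrefl refl (begin-strict
      1ℚ                                  <⟨ 1<3l ⟩
      l + l + l                           ≡⟨ ℚ.+-comm (l + l) l ⟩
      l + (l + l)                         ≤⟨ ℚ.+-mono-≤ (∈⇒≤weight ℕ._≟_ 0≤l openers≥l (opened b∈)) 2l≤joiners ⟩
      w openers b + w joiners b           ≡⟨ ℚ.+-identityʳ _ ⟨
      w openers b + w joiners b + 0ℚ      ≤⟨ ℚ.+-monoʳ-≤ (w openers b + w joiners b) (0≤weight ℕ._≟_ 0≤1-u big≥ b) ⟩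
      w openers b + w joiners b + w big b ≤⟨ weights≤1 valid b ⟩
      1ℚ                                  ∎)

    -- An opener, a joiner and an item `1ℚ - h` would again be three items of size at least `l`.
    disjoint : (∀ b → w (play g [] items) b ≤ 1ℚ) →
               ∀ {b} → b ∈ labels joiners → b ∉ labels big
    disjoint valid {b} b∈joiners b∈big = ℚ.<-irrefl refl (begin-strict
      1ℚ                                  <⟨ 1<3l ⟩
      l + l + l                           ≤⟨ ℚ.+-mono-≤ (ℚ.+-mono-≤
                                               (∈⇒≤weight ℕ._≟_ 0≤l openers≥l (opened b∈joiners))
                                               (∈⇒≤weight ℕ._≟_ 0≤l joiners≥l b∈joiners))
                                               (ℚ.≤-trans (ℚ.≤-trans l≤h u≤1-u) (∈⇒≤weight ℕ._≟_ 0≤1-u big≥ b∈big)) ⟩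
      w openers b + w joiners b + w big b ≤⟨ weights≤1 valid b ⟩
      1ℚ                                  ∎)

  attack-openers : r ℕ.≤ ℕ.⌈ length openers /2⌉ → Attack g l r
  attack-openers r≤c = record
    { items = items ; amount = amount ; sizes = sizes
    -- `c` bins for the openers in pairs, and one for each of the `y + c` items `1ℚ - lo`, which
    -- take in the joiners and the items `lo`.
    ; bins = c ℕ.+ (y ℕ.+ c) ; bins≤ = bins≤
    ; fits = permute rearrange (Fits-++
        (subst (λ n → Fits ℕ.⌈ n /2⌉ (map proj₁ openers)) (List.length-map proj₁ openers)
          (pair-off (ℚ.≤-trans 0≤l l≤h) (ℚ.<⇒≤ 2h<1) (All.map⁺ (All.map proj₂ openers-sizes))))
        (pair-up 0≤u (All.++⁺ (All.map⁺ (All.map proj₂ joiners-sizes)) (All.replicate⁺ q ℚ.≤-refl)) few))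
    ; used = λ valid → ℕ.≤-trans enough (used valid openers-distinct (disjoint valid)
        λ {b} b∈ → subst (b ∈_) (sym (List.map-++ proj₂ openers joiners)) (∈-++⁺ˡ b∈))
    }
    where
    f = length openers
    y = length joiners
    c = ℕ.⌈ f /2⌉
    q = ℕ.⌊ f /2⌋

    open LargePhase l≤lo (ℚ.≤-trans (ℚ.<⇒≤ lo<hi) hi≤h) (y ℕ.+ c) q (trans (ℕ.+-assoc y c q)
      (trans (cong (y ℕ.+_) (trans (ℕ.+-comm c q) (ℕ.⌊n/2⌋+⌈n/2⌉≡n f)))
        (trans (ℕ.+-comm y f) count)))

    rearrange : map proj₁ openers ++ (map proj₁ joiners ++ smalls) ++ bigs ↭ items
    rearrange = begin
      map proj₁ openers ++ (map proj₁ joiners ++ smalls) ++ bigs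
        ≡⟨ cong (map proj₁ openers ++_) (List.++-assoc (map proj₁ joiners) smalls bigs) ⟩
      map proj₁ openers ++ map proj₁ joiners ++ smalls ++ bigs
        ≡⟨ List.++-assoc (map proj₁ openers) (map proj₁ joiners) _ ⟨
      (map proj₁ openers ++ map proj₁ joiners) ++ smalls ++ bigs
        ↭⟨ Perm.++⁺ (↭-sym history↭) (Perm.++-comm smalls bigs) ⟩
      items ∎
      where open ↭.PermutationReasoning

    few : length (map proj₁ joiners ++ smalls) ℕ.≤ y ℕ.+ c
    few = begin
      length (map proj₁ joiners ++ smalls)          ≡⟨ List.length-++ (map proj₁ joiners) ⟩
      length (map proj₁ joiners) ℕ.+ length smalls  ≡⟨ cong₂ ℕ._+_ (List.length-map proj₁ joiners) (List.length-replicate q) ⟩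
      y ℕ.+ q                                       ≤⟨ ℕ.+-monoʳ-≤ y (ℕ.⌊n/2⌋≤⌈n/2⌉ f) ⟩
      y ℕ.+ c                                       ∎
      where open ℕ.≤-Reasoning

    c≤1+q : c ℕ.≤ suc q
    -- `⌈ f /2⌉` unfolds to `⌊ suc f /2⌋`, and `⌊ suc (suc f) /2⌋` to `suc q`.
    c≤1+q = ℕ.⌊n/2⌋-mono (ℕ.n≤1+n (suc f))

    -- `c + c` is `f` or `f + 1`: the extra bin occurs exactly when the number of openers is odd.
    bins≤ : c ℕ.+ (y ℕ.+ c) ℕ.≤ suc (3 ℕ.* r)
    bins≤ = begin
      c ℕ.+ (y ℕ.+ c)     ≡⟨ ℕ.+-comm c (y ℕ.+ c) ⟩
      y ℕ.+ c ℕ.+ c       ≡⟨ ℕ.+-assoc y c c ⟩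
      y ℕ.+ (c ℕ.+ c)     ≤⟨ ℕ.+-monoʳ-≤ y (ℕ.+-monoˡ-≤ c c≤1+q) ⟩
      y ℕ.+ suc (q ℕ.+ c) ≡⟨ cong (λ n → y ℕ.+ suc n) (ℕ.⌊n/2⌋+⌈n/2⌉≡n f) ⟩
      y ℕ.+ suc f         ≡⟨ ℕ.+-suc y f ⟩
      suc (y ℕ.+ f)       ≡⟨ cong suc (trans (ℕ.+-comm y f) count) ⟩
      suc (3 ℕ.* r)       ∎
      where open ℕ.≤-Reasoning

    enough : 4 ℕ.* r ℕ.≤ f ℕ.+ (y ℕ.+ c)
    enough = begin
      r ℕ.+ 3 ℕ.* r   ≡⟨ ℕ.+-comm r _ ⟩
      3 ℕ.* r ℕ.+ r   ≤⟨ ℕ.+-monoʳ-≤ (3 ℕ.* r) r≤c ⟩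
      3 ℕ.* r ℕ.+ c   ≡⟨ cong (ℕ._+ c) count ⟨
      f ℕ.+ y ℕ.+ c   ≡⟨ ℕ.+-assoc f y c ⟩
      f ℕ.+ (y ℕ.+ c) ∎
      where open ℕ.≤-Reasoning

    -- This is what the adaptive gap is for: an opener has size at least `hi`, which exceeds `lo`,
    -- so an item `1ℚ - lo` overflows its bin.
    disjoint : (∀ b → w (play g [] items) b ≤ 1ℚ) →
               ∀ {b} → b ∈ labels openers → b ∉ labels big
    disjoint valid {b} b∈openers b∈big = ℚ.<-irrefl refl (begin-strict
      1ℚ                                  ≡⟨ p+[1-p]≡1 lo ⟨
      lo + (1ℚ - lo)                      <⟨ ℚ.+-monoˡ-< _ lo<hi ⟩
      hi + (1ℚ - lo)                      ≤⟨ ℚ.+-mono-≤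
                                               (∈⇒≤weight ℕ._≟_ (ℚ.≤-trans 0≤u (ℚ.<⇒≤ lo<hi)) (All.map proj₁ openers-sizes) b∈openers)
                                               (∈⇒≤weight ℕ._≟_ 0≤1-u big≥ b∈big) ⟩
      w openers b + w big b               ≡⟨ cong (_+ w big b) (ℚ.+-identityʳ (w openers b)) ⟨
      w openers b + 0ℚ + w big b          ≤⟨ ℚ.+-monoˡ-≤ _ (ℚ.+-monoʳ-≤ (w openers b) (0≤weight ℕ._≟_ 0≤l joiners≥l b)) ⟩
      w openers b + w joiners b + w big b ≤⟨ weights≤1 valid b ⟩
      1ℚ                                  ∎)
      where open ℚ.≤-Reasoning

  attack : Attack g l r
  attack with r ℕ.≤? length joiners | r ℕ.≤? ℕ.⌈ length openers /2⌉
  ... | yes r≤y | _       = attack-joiners r≤y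
  ... | no  _   | yes r≤c = attack-openers r≤c
  -- Since `f` is at most `c + c`, having both `c < r` and `y < r` would make `f + y` less than
  -- `3 * r`, against `count`.
  ... | no  r≰y | no  r≰c = contradiction count (ℕ.<⇒≢ (begin-strict
    f ℕ.+ y                 ≡⟨ cong (ℕ._+ y) (ℕ.⌊n/2⌋+⌈n/2⌉≡n f) ⟨
    ℕ.⌊ f /2⌋ ℕ.+ c ℕ.+ y   ≤⟨ ℕ.+-monoˡ-≤ y (ℕ.+-monoˡ-≤ c (ℕ.⌊n/2⌋≤⌈n/2⌉ f)) ⟩
    c ℕ.+ c ℕ.+ y           <⟨ ℕ.+-mono-< (ℕ.+-mono-< c<r c<r) (ℕ.≰⇒> r≰y) ⟩
    r ℕ.+ r ℕ.+ r           ≡⟨ ℕ.+-assoc r r r ⟩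
    r ℕ.+ (r ℕ.+ r)         ≡⟨ cong (λ n → r ℕ.+ (r ℕ.+ n)) (ℕ.+-identityʳ r) ⟨
    3 ℕ.* r                 ∎))
    where
    open ℕ.≤-Reasoning
    f = length openers
    y = length joiners
    c = ℕ.⌈ f /2⌉
    c<r : c ℕ.< r
    c<r = ℕ.≰⇒> r≰c

-- Rational arithmetic for the asymptotic comparison.

-- `_/_` normalises its fraction, which does not reduce for a variable numerator; facts about `ℕ→ℚ`
-- are therefore proved on unnormalised fractions with denominator 1, stored as 0.
ℕ→ℚ≃ : ∀ m → ℚ.toℚᵘ (ℕ→ℚ m) ℚᵘ.≃ ℚᵘ.mkℚᵘ (+ m) 0
ℕ→ℚ≃ m = ℚ.toℚᵘ-fromℚᵘ (ℚᵘ.mkℚᵘ (+ m) 0)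

ℕ→ℚ-mono-≤ : m ℕ.≤ n → ℕ→ℚ m ≤ ℕ→ℚ n
ℕ→ℚ-mono-≤ {m} {n} m≤n = ℚ.toℚᵘ-cancel-≤ (begin
  ℚ.toℚᵘ (ℕ→ℚ m)  ≃⟨ ℕ→ℚ≃ m ⟩
  ℚᵘ.mkℚᵘ (+ m) 0 ≤⟨ ℚᵘ.*≤* (ℤ.*-monoʳ-≤-nonNeg (+ 1) (ℤ.+≤+ m≤n)) ⟩
  ℚᵘ.mkℚᵘ (+ n) 0 ≃⟨ ℕ→ℚ≃ n ⟨
  ℚ.toℚᵘ (ℕ→ℚ n)  ∎)
  where open ℚᵘ.≤-Reasoning

ℕ→ℚ-homo-+ : ∀ m n → ℕ→ℚ (m ℕ.+ n) ≡ ℕ→ℚ m + ℕ→ℚ n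
ℕ→ℚ-homo-+ m n = ℚ.toℚᵘ-injective (begin-equality
  ℚ.toℚᵘ (ℕ→ℚ (m ℕ.+ n))                    ≃⟨ ℕ→ℚ≃ (m ℕ.+ n) ⟩
  ℚᵘ.mkℚᵘ (+ (m ℕ.+ n)) 0                   ≡⟨ cong₂ (λ i j → ℚᵘ.mkℚᵘ (i ℤ.+ j) 0) (ℤ.*-identityʳ (+ m)) (ℤ.*-identityʳ (+ n)) ⟨
  ℚᵘ.mkℚᵘ (+ m) 0 ℚᵘ.+ ℚᵘ.mkℚᵘ (+ n) 0      ≃⟨ ℚᵘ.+-cong (ℕ→ℚ≃ m) (ℕ→ℚ≃ n) ⟨
  ℚ.toℚᵘ (ℕ→ℚ m) ℚᵘ.+ ℚ.toℚᵘ (ℕ→ℚ n)        ≃⟨ ℚ.toℚᵘ-homo-+ (ℕ→ℚ m) (ℕ→ℚ n) ⟨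
  ℚ.toℚᵘ (ℕ→ℚ m + ℕ→ℚ n)                    ∎)
  where open ℚᵘ.≤-Reasoning

archimedean : ∀ p → ∃ λ n → p < ℕ→ℚ n
archimedean p@record{} = bound , ℚ.toℚᵘ-cancel-< (begin-strict
  ℚ.toℚᵘ p            <⟨ ℚᵘ.*<* (subst (ℤ._< (+ bound ℤ.* ℚ.↧ p)) (sym (ℤ.*-identityʳ (ℚ.↥ p))) (i<[1+∣i∣]*d (ℚ.↥ p))) ⟩
  ℚᵘ.mkℚᵘ (+ bound) 0 ≃⟨ ℕ→ℚ≃ bound ⟨
  ℚ.toℚᵘ (ℕ→ℚ bound)  ∎)
  where
  open ℚᵘ.≤-Reasoning
  bound : ℕ
  -- The denominator is at least 1, so one more than the absolute value of the numerator exceeds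
  -- `p`.
  bound = suc ℤ.∣ ℚ.↥ p ∣
  i<[1+∣i∣]*d : ∀ i → i ℤ.< + suc ℤ.∣ i ∣ ℤ.* (ℚ.↧ p)
  i<[1+∣i∣]*d (+ i)      = ℤ.+<+ (ℕ.m≤m*n (suc i) (ℚ.↧ₙ p))
  i<[1+∣i∣]*d ℤ.-[1+ i ] = ℤ.-<+

-- The inequality amounts to `c + K < ε * r` with `ε = 4 - 3c` positive, so any `r` above
-- `(c + K) * (1/ ε)` works; the extra bin costs only the constant `c`.
linear-gap : ∀ {c} K → c < (+ 4) / 3 →
             ∃ λ r → c * ℕ→ℚ (suc (3 ℕ.* r)) + K < ℕ→ℚ (4 ℕ.* r)
linear-gap {c} K c<4/3 = r , (begin-strict
  c * ℕ→ℚ (suc (3 ℕ.* r)) + K  ≡⟨ cong (λ x → c * x + K) (trans (ℕ→ℚ-homo-+ 1 (3 ℕ.* r)) (cong (_+_ 1ℚ) (triple r))) ⟩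
  c * (1ℚ + (a + (a + a))) + K ≡⟨ solve 3
    (λ c K a → c :* (con 1ℚ :+ (a :+ (a :+ a))) :+ K := c :+ K :+ (c :+ c :+ c) :* a) refl c K a ⟩
  c + K + (c + c + c) * a      ≡⟨ cong (_+ (c + c + c) * a) scale ⟨
  (c + K) * (1/ ε) * ε + (c + c + c) * a <⟨ ℚ.+-monoˡ-< _ (ℚ.*-monoˡ-<-pos ε large) ⟩
  a * ε + (c + c + c) * a      ≡⟨ solve 2
    (λ c a → a :* (con ((+ 4) / 1) :- (c :+ c :+ c)) :+ (c :+ c :+ c) :* a := a :+ (a :+ (a :+ a))) refl c a ⟩
  a + (a + (a + a))            ≡⟨ cong (_+_ a) (triple r) ⟨
  a + ℕ→ℚ (3 ℕ.* r)            ≡⟨ ℕ→ℚ-homo-+ r (3 ℕ.* r) ⟨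
  ℕ→ℚ (4 ℕ.* r)                ∎)
  where
  open ℚ.≤-Reasoning
  open +-*-Solver
  ε : ℚ
  ε = (+ 4) / 1 - (c + c + c)
  0<ε : 0ℚ < ε
  0<ε = begin-strict
    0ℚ                        ≡⟨ ℚ.+-inverseʳ (c + c + c) ⟨
    c + c + c - (c + c + c)   <⟨ ℚ.+-monoˡ-< _ (ℚ.+-mono-< (ℚ.+-mono-< c<4/3 c<4/3) c<4/3) ⟩
    ε                         ∎
  instance
    ε-positive : Positive ε
    ε-positive = positive 0<ε
    ε-nonZero : NonZero ε
    ε-nonZero = ℚ.pos⇒nonZero ε
  r : ℕ
  r = proj₁ (archimedean ((c + K) * (1/ ε)))
  large : (c + K) * (1/ ε) < ℕ→ℚ r
  large = proj₂ (archimedean ((c + K) * (1/ ε)))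
  a : ℚ
  a = ℕ→ℚ r
  scale : (c + K) * (1/ ε) * ε ≡ c + K
  scale = trans (ℚ.*-assoc (c + K) (1/ ε) ε)
    (trans (cong ((c + K) *_) (ℚ.*-inverseˡ ε)) (ℚ.*-identityʳ _))
  triple : ∀ r → ℕ→ℚ (3 ℕ.* r) ≡ ℕ→ℚ r + (ℕ→ℚ r + ℕ→ℚ r)
  triple r = trans (ℕ→ℚ-homo-+ r (r ℕ.+ (r ℕ.+ 0))) (cong (_+_ (ℕ→ℚ r))
    (trans (ℕ→ℚ-homo-+ r (r ℕ.+ 0)) (cong (λ n → ℕ→ℚ r + ℕ→ℚ n) (ℕ.+-identityʳ r))))

-- Transfer to the online problem, and conclusion.

as-vector : (xs : List A) → length xs ≡ n → ∃ λ (ys : Vec A n) → toList ys ≡ xs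
as-vector xs refl = Vec.fromList xs , Vec.toList∘fromList xs

binsUsed≡ : ∀ (A : OnlineAlg) (es ss : Vec ℚ n) →
            binsUsed A es ss ≡ length (deduplicate ℕ._≟_ (labels (play (A n es) [] (toList ss))))
binsUsed≡ {n} A es ss = cong (length ∘ deduplicate ℕ._≟_) (begin
  map (run A es ss) (allFin n)                        ≡⟨ List.map-tabulate id (run A es ss) ⟩
  tabulate (run A es ss)                              ≡⟨ List.map-tabulate (λ i → lookup ss i , run A es ss i) proj₂ ⟨
  labels (tabulate (λ i → lookup ss i , run A es ss i)) ≡⟨ cong labels (play-run A es ss) ⟩
  labels (play (A n es) [] (toList ss))               ∎)
  where open ≡-Reasoning

-- Estimate 1/2 with accuracy `δ` allows deviations up to `½ * δ`; the sizes deviate by at most `d`,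
-- a quarter of that. The bound `d ≤ ½` keeps them at most 1.
admissible : ∀ {δ d} → d + d + d + d ≡ ½ * δ → 0ℚ ≤ d → d ≤ ½ → (ss : Vec ℚ n) →
             All (λ x → ½ - d ≤ x × x ≤ 1ℚ - (½ - d)) (toList ss) →
             Admissible δ (Vec.replicate n ½) ss
admissible {n} {δ} {d} 4d≡½δ 0≤d d≤½ ss sizes i
  rewrite Vec.lookup-replicate i ½ = 0<½ , ½≤1 , lower , upper
  where
  open ℚ.≤-Reasoning
  open +-*-Solver
  s : ℚ
  s = lookup ss i
  bounds : ½ - d ≤ s × s ≤ 1ℚ - (½ - d)
  bounds = All.lookup sizes (∈-toList⁺ (∈-lookup i ss))
  0<½ : 0ℚ < ½
  0<½ = ℚ.positive⁻¹ ½
  ½≤1 : ½ ≤ 1ℚ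
  ½≤1 = ℚ.≤ᵇ⇒≤ _
  d≤½δ : d ≤ ½ * δ
  d≤½δ = begin
    d                  ≡⟨ solve 1 (λ d → d := con 0ℚ :+ con 0ℚ :+ con 0ℚ :+ d) refl d ⟩
    0ℚ + 0ℚ + 0ℚ + d   ≤⟨ ℚ.+-monoˡ-≤ d (ℚ.+-mono-≤ (ℚ.+-mono-≤ 0≤d 0≤d) 0≤d) ⟩
    d + d + d + d      ≡⟨ 4d≡½δ ⟩
    ½ * δ              ∎
  lower : ½ * (1ℚ - δ) ≤ s
  lower = begin
    ½ * (1ℚ - δ)       ≡⟨ solve 1 (λ δ → con ½ :* (con 1ℚ :- δ) := con ½ :- con ½ :* δ) refl δ ⟩
    ½ - ½ * δ          ≤⟨ ℚ.+-monoʳ-≤ ½ (ℚ.neg-antimono-≤ d≤½δ) ⟩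
    ½ - d              ≤⟨ proj₁ bounds ⟩
    s                  ∎
  1-[½-d]≡½+d : 1ℚ - (½ - d) ≡ ½ + d
  1-[½-d]≡½+d = solve 1 (λ d → con 1ℚ :- (con ½ :- d) := con ½ :+ d) refl d
  upper : s ≤ (½ * (1ℚ + δ)) ⊓ 1ℚ
  upper = ℚ.⊓-glb
    (begin
      s              ≤⟨ proj₂ bounds ⟩
      1ℚ - (½ - d)   ≡⟨ 1-[½-d]≡½+d ⟩
      ½ + d          ≤⟨ ℚ.+-monoʳ-≤ ½ d≤½δ ⟩
      ½ + ½ * δ      ≡⟨ solve 1 (λ δ → con ½ :* (con 1ℚ :+ δ) := con ½ :+ con ½ :* δ) refl δ ⟨
      ½ * (1ℚ + δ)   ∎)
    (begin
      s              ≤⟨ proj₂ bounds ⟩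
      1ℚ - (½ - d)   ≡⟨ 1-[½-d]≡½+d ⟩
      ½ + d          ≤⟨ ℚ.+-monoʳ-≤ ½ d≤½ ⟩
      1ℚ             ∎)

theorem1 : (δ : ℚ) → 0ℚ < δ → δ ≤ 1ℚ → (c : ℚ) → c < (+ 4) / 3 →
    ¬ (Σ OnlineAlg λ A → Valid δ A × Competitive δ A c)
theorem1 δ 0<δ δ≤1 c c<4/3 (A , valid , K , competitive) =
  ¬¬IsOPT ss (subst (Fits bins) (sym ss≡items) fits) λ k k≤bins opt → ℚ.<-irrefl refl (begin-strict
    ℕ→ℚ (4 ℕ.* r)                   ≤⟨ ℕ→ℚ-mono-≤ 4r≤used ⟩
    ℕ→ℚ (binsUsed A es ss)          ≤⟨ competitive N es ss ok k opt ⟩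
    c * ℕ→ℚ k + K                   ≤⟨ ℚ.+-monoˡ-≤ K
      (ℚ.*-monoʳ-≤-nonNeg (ℕ→ℚ k) {{nonNegative (ℕ→ℚ-mono-≤ {0} {k} ℕ.z≤n)}} (ℚ.p≤p⊔q c 0ℚ)) ⟩
    c⁺ * ℕ→ℚ k + K                  ≤⟨ ℚ.+-monoˡ-≤ K
      (ℚ.*-monoˡ-≤-nonNeg c⁺ {{nonNegative (ℚ.p≤q⊔p c 0ℚ)}} (ℕ→ℚ-mono-≤ (ℕ.≤-trans k≤bins bins≤))) ⟩
    c⁺ * ℕ→ℚ (suc (3 ℕ.* r)) + K    <⟨ proj₂ gap ⟩
    ℕ→ℚ (4 ℕ.* r)                   ∎)
  where
  open ℚ.≤-Reasoning
  open +-*-Solver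

  -- For negative c the right-hand side c * k + K would decrease in k.
  c⁺ : ℚ
  c⁺ = c ⊔ 0ℚ
  c⁺<4/3 : c⁺ < (+ 4) / 3
  c⁺<4/3 with ℚ.⊔-sel c 0ℚ
  ... | inj₁ eq = subst (_< (+ 4) / 3) (sym eq) c<4/3
  ... | inj₂ eq = subst (_< (+ 4) / 3) (sym eq) (ℚ.positive⁻¹ ((+ 4) / 3))
  -- `r` depends only on `c⁺` and `K`, so the number of items and their estimates are fixed before
  -- the algorithm is consulted.
  gap = linear-gap K c⁺<4/3
  r N : ℕ
  r = proj₁ gap
  N = 3 ℕ.* r ℕ.+ 3 ℕ.* r
  es : Vec ℚ N
  es = Vec.replicate N ½

  ⅛ d l : ℚ
  ⅛ = (+ 1) / 8
  -- With `δ ≤ 1` this gives `l ≥ 3/8`, so that `1 < l + l + l` holds for every accuracy.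
  d = ⅛ * δ
  l = ½ - d
  0<d : 0ℚ < d
  0<d = subst (_< d) (ℚ.*-zeroʳ ⅛) (ℚ.*-monoʳ-<-pos ⅛ 0<δ)
  d≤⅛ : d ≤ ⅛
  d≤⅛ = ℚ.*-monoˡ-≤-nonNeg ⅛ δ≤1
  3/8≤l : ½ - ⅛ ≤ l
  3/8≤l = ℚ.+-monoʳ-≤ ½ (ℚ.neg-antimono-≤ d≤⅛)
  l<½ : l < ½
  l<½ = ℚ.+-monoʳ-< ½ (ℚ.neg-antimono-< 0<d)
  -- Both inequalities are strict: `l<h` leaves room for the adaptive sizes, `h<½` gives
  -- `h + h < 1`.
  h : ℚ
  h = proj₁ (ℚ.<-dense l<½)
  l<h : l < h
  l<h = proj₁ (proj₂ (ℚ.<-dense l<½))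
  h<½ : h < ½
  h<½ = proj₂ (proj₂ (ℚ.<-dense l<½))

  strategy : Attack (A N es) l r
  strategy = attack (ℚ.≤-trans (ℚ.≤ᵇ⇒≤ _) 3/8≤l)
    (ℚ.<-≤-trans (from-yes (1ℚ ℚ.<? ½ - ⅛ + (½ - ⅛) + (½ - ⅛))) (ℚ.+-mono-≤ (ℚ.+-mono-≤ 3/8≤l 3/8≤l) 3/8≤l))
    (ℚ.+-mono-< h<½ h<½)
    (small-phase (A N es) l<h (3 ℕ.* r))
  open Attack strategy

  ss : Vec ℚ N
  ss = proj₁ (as-vector items amount)
  ss≡items : toList ss ≡ items
  ss≡items = proj₂ (as-vector items amount)

  ok : Admissible δ es ss
  ok = admissible {δ = δ}
    (solve 1 (λ δ → con ⅛ :* δ :+ con ⅛ :* δ :+ con ⅛ :* δ :+ con ⅛ :* δ := con ½ :* δ) refl δ)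
    (ℚ.<⇒≤ 0<d) (ℚ.≤-trans d≤⅛ (ℚ.≤ᵇ⇒≤ _)) ss (subst (All _) (sym ss≡items) sizes)

  played : tabulate (λ i → lookup ss i , run A es ss i) ≡ play (A N es) [] items
  played = trans (play-run A es ss) (cong (play (A N es) []) ss≡items)

  4r≤used : 4 ℕ.* r ℕ.≤ binsUsed A es ss
  4r≤used = subst (4 ℕ.* r ℕ.≤_)
    (sym (trans (binsUsed≡ A es ss)
      (cong (λ xs → length (deduplicate ℕ._≟_ (labels (play (A N es) [] xs)))) ss≡items)))
    -- Validity bounds `load` on the realised input, which is the capacity bound that `used`
    -- assumes.
    (used λ b → subst (_≤ 1ℚ)
      (trans (load≡weight ℕ._≟_ ss (run A es ss) b) (cong (λ P → w P b) played))
      (valid N es ss ok b))
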